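{- Let $G$ be a graph of density $p$ with $\mathrm{disc}^+(G) = \alpha > 0$. Then \[ f(G) \geq (1-p)^{ -1/2} (2\alpha)^{1/2}. \]
   Context: Graphs are finite and simple. The density of a graph $G$ on $n \geq 2$ vertices is $p = |E(G)|/\binom{n}{2}$. A full subgraph of a graph $G$ of density $p$ is an $m$-vertex subgraph $H$ of $G$ of minimum degree at least $p(m-1)$; $f(G)$ denotes the largest number of vertices in a full subgraph of $G$. For $X \subseteq V(G)$, $e(X)$ is the number of edges of $G$ lying in $X$, and $\delta(X) = e(X) - p\binom{|X|}{2}$, where $p$ is the density of $G$. The positive discrepancy of $G$ is $\mathrm{disc}^+(G) = \max_{X \subseteq V(G)} \delta(X)$. -}

module Defs where

open import Data.Bool.Base using (true; false; if_then_else_)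
open import Data.Fin.Base as Fin using (Fin)
import Data.Fin.Properties as Fin
open import Data.Fin.Subset using (Subset; inside; outside; ⊥; ∣_∣; _∈_)
open import Data.Fin.Subset.Properties using (_∈?_)
open import Data.Integer.Base as ℤ using (+_)
import Data.Integer.Properties as ℤ
open import Data.List.Base using (List; []; _∷_; _++_; map; filter; length; allFin)
import Data.List.Extrema as Extrema
import Data.List.Extrema.Nat as ℕExtrema
open import Data.List.Membership.Propositional using () renaming (_∈_ to _∈ˡ_)
open import Data.List.Membership.Propositional.Properties using (∈-map⁺; ∈-++⁺ˡ; ∈-++⁺ʳ)
open import Data.List.Properties using (length-++; length-map; filter-++; map-tabulate)
open import Data.List.Relation.Binary.Sublist.Propositional using (⊆-refl)
import Data.List.Relation.Binary.Sublist.Propositional.Properties as Sublist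
open import Data.List.Relation.Unary.All as All using (All)
open import Data.List.Relation.Unary.All.Properties using (map⁺)
open import Data.List.Relation.Unary.Any using (here)
open import Data.Nat.Base as ℕ using (ℕ; zero; suc; NonTrivial)
open import Data.Nat.Combinatorics using (_C_; nC1≡n; nCk+nC[k+1]≡[n+1]C[k+1])
import Data.Nat.Properties as ℕ
open import Data.Product using (Σ-syntax; ∃; _×_; _,_; proj₁; proj₂)
open import Data.Rational hiding (∣_∣)
open import Data.Rational.Properties
import Data.Rational.Unnormalised.Base as ℚᵘ
import Data.Rational.Unnormalised.Properties as ℚᵘ
open import Data.Sum.Base using (inj₁; inj₂)
open import Data.Vec.Base using ([]; _∷_)
open import Function.Base using (_∘_; id; case_of_)
open import Relation.Binary.Bundles using (DecTotalOrder)
open import Relation.Binary.Definitions using (Decidable; Symmetric; Irreflexive)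
open import Relation.Binary.PropositionalEquality
open import Relation.Nullary using (¬_; Dec; does)
open import Relation.Nullary.Decidable using (_×-dec_; _→-dec_; map′)

open Extrema (DecTotalOrder.totalOrder ≤-decTotalOrder) using (max; max≤v⁺)

record Graph (n : ℕ) : Set₁ where
  infix 4 _~_ _~?_
  field
    _~_    : Fin n → Fin n → Set
    _~?_   : Decidable _~_
    ~-sym  : Symmetric _~_
    ~-irr  : Irreflexive _≡_ _~_

-- The unordered pairs of entries at distinct positions of a list, each
-- listed once.
pairs : {A : Set} → List A → List (A × A)
pairs []       = []
pairs (x ∷ xs) = map (x ,_) xs ++ pairs xs

subsets : ∀ n → List (Subset n)
subsets zero    = [] ∷ []
subsets (suc n) = map (inside ∷_) (subsets n) ++ map (outside ∷_) (subsets n)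

∈-subsets : ∀ {n} (X : Subset n) → X ∈ˡ subsets n
∈-subsets []            = here refl
∈-subsets (inside ∷ X)  = ∈-++⁺ˡ (∈-map⁺ (inside ∷_) (∈-subsets X))
∈-subsets (outside ∷ X) =
  ∈-++⁺ʳ (map (inside ∷_) (subsets _)) (∈-map⁺ (outside ∷_) (∈-subsets X))

nC2-nonZero : ∀ n .{{_ : NonTrivial n}} → ℕ.NonZero (n C 2)
nC2-nonZero (suc (suc k)) = ℕ.≢-nonZero λ eq →
  case trans (cong (ℕ._+ suc k C 2) (sym (nC1≡n (suc k))))
       (trans (nCk+nC[k+1]≡[n+1]C[k+1] (suc k) 1) eq) of λ ()

<⇒≱ : ∀ {q r : ℚ} → q < r → ¬ r ≤ q
<⇒≱ q<r r≤q = <-irrefl refl (<-≤-trans q<r r≤q)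

infix 9 ↑_
↑_ : ℕ → ℚ
↑ m = + m / 1

module _ {n : ℕ} (G : Graph n) where
  open Graph G

  edges : List (Fin n × Fin n)
  edges = filter (λ (u , v) → u ~? v) (pairs (allFin n))

  degree : Fin n → ℕ
  degree v = length (filter (v ~?_) (allFin n))

  e : Subset n → ℕ
  e X = length (filter (λ (u , v) → (u ∈? X) ×-dec (v ∈? X)) edges)

  density : .{{NonTrivial n}} → ℚ
  density = (+ length edges / (n C 2)) {{nC2-nonZero n}}

  δ : .{{NonTrivial n}} → Subset n → ℚ
  δ X = ↑ e X - density * ↑ (∣ X ∣ C 2)

  disc⁺ : .{{NonTrivial n}} → ℚ
  disc⁺ = max (δ ⊥) (map δ (subsets n))

-- Subgraphs need not be induced.  The vertices of `graph` outside
-- `vertices` are isolated, so degrees in `graph` are degrees in the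
-- subgraph.
record Subgraph {n} (G : Graph n) : Set₁ where
  field
    vertices : Subset n
    graph    : Graph n
    ends     : ∀ {u v} → Graph._~_ graph u v → u ∈ vertices × v ∈ vertices
    ⊆-graph  : ∀ {u v} → Graph._~_ graph u v → Graph._~_ G u v

module _ {n : ℕ} (G : Graph n) .{{_ : NonTrivial n}} where

  -- Minimum degree at least p (m - 1).  The empty subgraph satisfies this
  -- vacuously; a single vertex is also full, so it never affects the maximum.
  Full : Subgraph G → Set
  Full H = ∀ v → v ∈ vertices →
           ↑ degree graph v ≥ density G * (↑ ∣ vertices ∣ - 1ℚ)
    where open Subgraph H

  SpansFull : Subset n → Set₁
  SpansFull S = Σ[ H ∈ Subgraph G ] Subgraph.vertices H ≡ S × Full H

induced : ∀ {n} (G : Graph n) → Subset n → Subgraph G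
induced G S = record
  { vertices = S
  ; graph    = record
    { _~_   = λ u v → (u ∈ S × v ∈ S) × u ~ v
    ; _~?_  = λ u v → ((u ∈? S) ×-dec (v ∈? S)) ×-dec (u ~? v)
    ; ~-sym = λ ((u∈S , v∈S) , u~v) → (v∈S , u∈S) , ~-sym u~v
    ; ~-irr = λ u≡v (_ , u~v) → ~-irr u≡v u~v
    }
  ; ends     = proj₁
  ; ⊆-graph  = proj₂
  }
  where open Graph G

↑-mono-≤ : ∀ {m k} → m ℕ.≤ k → ↑ m ≤ ↑ k
↑-mono-≤ {m} {k} m≤k = toℚᵘ-cancel-≤
  (ℚᵘ.≤-respˡ-≃ (ℚᵘ.≃-sym (toℚᵘ-homo-/ m))
  (ℚᵘ.≤-respʳ-≃ (ℚᵘ.≃-sym (toℚᵘ-homo-/ k))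
  (ℚᵘ.*≤* (ℤ.*-monoʳ-≤-nonNeg (+ 1) (ℤ.+≤+ m≤k)))))
  where
  toℚᵘ-homo-/ : ∀ j → toℚᵘ (↑ j) ℚᵘ.≃ ℚᵘ.mkℚᵘ (+ j) 0
  toℚᵘ-homo-/ j = toℚᵘ-fromℚᵘ (ℚᵘ.mkℚᵘ (+ j) 0)

spansFull? : ∀ {n} (G : Graph n) .{{_ : NonTrivial n}} →
             ∀ S → Dec (SpansFull G S)
spansFull? {n} G S = map′ (λ full → induced G S , refl , full) fromFull
  (Fin.all? λ v → (v ∈? S) →-dec (_ ≤? _))
  where
  fromFull : SpansFull G S → Full G (induced G S)
  fromFull (H , refl , full) v v∈S = ≤-trans (full v v∈S)
    (↑-mono-≤ (Sublist.length-mono-≤ (Sublist.filter⁺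
      (Graph._~?_ (Subgraph.graph H) v)
      (Graph._~?_ (Subgraph.graph (induced G S)) v)
      (λ { refl v~u → Subgraph.ends H v~u , Subgraph.⊆-graph H v~u })
      (⊆-refl {x = allFin n}))))

f : ∀ {n} (G : Graph n) .{{_ : NonTrivial n}} → ℕ
f {n} G = ℕExtrema.max 0 (map ∣_∣ (filter (spansFull? G) (subsets n)))

length-filter-map : ∀ {A B : Set} {P : B → Set} (P? : ∀ b → Dec (P b))
                    (g : A → B) xs →
                    length (filter P? (map g xs)) ≡ length (filter (P? ∘ g) xs)
length-filter-map P? g []       = refl
length-filter-map P? g (x ∷ xs) with does (P? (g x))
... | true  = cong suc (length-filter-map P? g xs)
... | false = length-filter-map P? g xs

length-filter-cong : ∀ {A : Set} {P Q : A → Set}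
                     (P? : ∀ a → Dec (P a)) (Q? : ∀ a → Dec (Q a)) →
                     (∀ a → does (P? a) ≡ does (Q? a)) → ∀ xs →
                     length (filter P? xs) ≡ length (filter Q? xs)
length-filter-cong P? Q? eq []       = refl
length-filter-cong P? Q? eq (x ∷ xs) with does (P? x) | does (Q? x) | eq x
... | true  | true  | _ = cong suc (length-filter-cong P? Q? eq xs)
... | false | false | _ = length-filter-cong P? Q? eq xs

length-filter-∈ : ∀ {n} (X : Subset n) →
                  length (filter (_∈? X) (allFin n)) ≡ ∣ X ∣
length-filter-∈ []       = refl
length-filter-∈ {suc n} (b ∷ X) = go b
  where
  tail : ∀ b → length (filter (_∈? (b ∷ X)) (map Fin.suc (allFin n))) ≡ ∣ X ∣
  tail b = trans (length-filter-map (_∈? (b ∷ X)) Fin.suc (allFin n))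
    (trans (length-filter-cong ((_∈? (b ∷ X)) ∘ Fin.suc) (_∈? X) (λ _ → refl) (allFin n))
           (length-filter-∈ X))
  go : ∀ b → length (filter (_∈? (b ∷ X)) (allFin (suc n))) ≡ ∣ b ∷ X ∣
  go inside  rewrite sym (map-tabulate {n = n} id Fin.suc) = cong suc (tail inside)
  go outside rewrite sym (map-tabulate {n = n} id Fin.suc) = tail outside

length-pairs : ∀ {A : Set} (xs : List A) → length (pairs xs) ≡ length xs C 2
length-pairs []       = refl
length-pairs (x ∷ xs) = begin
  length (map (x ,_) xs ++ pairs xs)         ≡⟨ length-++ (map (x ,_) xs) ⟩
  length (map (x ,_) xs) ℕ.+ length (pairs xs)
    ≡⟨ cong₂ ℕ._+_ (trans (length-map (x ,_) xs) (sym (nC1≡n (length xs)))) (length-pairs xs) ⟩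
  length xs C 1 ℕ.+ length xs C 2            ≡⟨ nCk+nC[k+1]≡[n+1]C[k+1] (length xs) 1 ⟩
  suc (length xs) C 2                        ∎
  where open ≡-Reasoning

module _ {A : Set} {P : A → Set} (P? : ∀ a → Dec (P a)) where

  both? : (xy : A × A) → Dec (P (proj₁ xy) × P (proj₂ xy))
  both? (x , y) = P? x ×-dec P? y

  length-filter-pairs : ∀ xs → length (filter both? (pairs xs)) ≡ length (filter P? xs) C 2
  length-filter-pairs xs = trans (cong length (filter-pairs xs)) (length-pairs (filter P? xs))
    where
    row : ∀ x ys → filter both? (map (x ,_) ys) ≡
                   (if does (P? x) then map (x ,_) (filter P? ys) else [])
    row x [] with does (P? x)
    ... | true  = refl
    ... | false = refl
    row x (y ∷ ys) with does (P? x) | row x ys | does (P? y)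
    ... | true  | ih | true  = cong ((x , y) ∷_) ih
    ... | true  | ih | false = ih
    ... | false | ih | _     = ih

    filter-pairs : ∀ xs → filter both? (pairs xs) ≡ pairs (filter P? xs)
    filter-pairs []       = refl
    filter-pairs (x ∷ xs) rewrite filter-++ both? (map (x ,_) xs) (pairs xs)
      with does (P? x) | row x xs
    ... | true  | eq = cong₂ _++_ eq (filter-pairs xs)
    ... | false | eq = cong₂ _++_ eq (filter-pairs xs)

module _ {n : ℕ} (G : Graph n) where

  e≤ : ∀ X → e G X ℕ.≤ ∣ X ∣ C 2
  e≤ X = begin
    e G X
      ≤⟨ Sublist.length-mono-≤ (Sublist.filter⁺ (both? (_∈? X)) (both? (_∈? X))
           (λ { refl x → x }) (Sublist.filter-⊆ _ (pairs (allFin n)))) ⟩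
    length (filter (both? (_∈? X)) (pairs (allFin n)))
      ≡⟨ length-filter-pairs (_∈? X) (allFin n) ⟩
    length (filter (_∈? X) (allFin n)) C 2
      ≡⟨ cong (_C 2) (length-filter-∈ X) ⟩
    ∣ X ∣ C 2 ∎
    where open ℕ.≤-Reasoning

  δ≤0 : .{{_ : NonTrivial n}} → 1ℚ ≤ density G → ∀ X → δ G X ≤ 0ℚ
  δ≤0 1≤p X = begin
    ↑ e G X - p * c  ≤⟨ +-monoˡ-≤ (- (p * c)) (↑-mono-≤ (e≤ X)) ⟩
    c - p * c        ≡⟨ cong (_- p * c) (sym (*-identityˡ c)) ⟩
    1ℚ * c - p * c   ≤⟨ +-monoˡ-≤ (- (p * c))
                          (*-monoʳ-≤-nonNeg c {{nonNegative (↑-mono-≤ {0} {∣ X ∣ C 2} ℕ.z≤n)}} 1≤p) ⟩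
    p * c - p * c    ≡⟨ +-inverseʳ (p * c) ⟩
    0ℚ               ∎
    where
    open ≤-Reasoning
    p c : ℚ
    p = density G
    c = ↑ (∣ X ∣ C 2)

  0<1-p : .{{_ : NonTrivial n}} → ∀ {p α} →
          density G ≡ p → disc⁺ G ≡ α → 0ℚ < α → 0ℚ < 1ℚ - p
  0<1-p {p} refl refl 0<α = subst (_< 1ℚ - p) (+-inverseʳ p)
    (+-monoˡ-< (- p) (≰⇒> λ 1≤p → <⇒≱ 0<α
      (max≤v⁺ (δ≤0 1≤p ⊥) (map⁺ (All.universal (δ≤0 1≤p) (subsets n))))))

-- A positive real is given by its left Dedekind cut, as in Rudin: q ◃ x
-- means q < x.
record ℝ⁺ : Set₁ where
  infix 4 _◃
  field
    _◃       : ℚ → Set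
    0◃       : 0ℚ ◃
    bounded  : ∃ λ b → ¬ b ◃
    down     : ∀ {q r} → q < r → r ◃ → q ◃
    rounded  : ∀ {q} → q ◃ → ∃ λ r → q < r × r ◃

infix 4 _◃_
_◃_ : ℚ → ℝ⁺ → Set
q ◃ x = ℝ⁺._◃ x q

-- q ≥ x, where q is a (possibly zero) rational: the cut of x lies below q.
infix 4 _≥ᴿ_
_≥ᴿ_ : ℚ → ℝ⁺ → Set
q ≥ᴿ x = ∀ {r} → r ◃ x → r ≤ q

sup : (S : ℚ → Set) → (∃ λ s → S s × 0ℚ < s) → (∃ λ b → ∀ s → S s → s ≤ b) → ℝ⁺
sup S 0<S (b , S≤b) = record
  { _◃       = λ q → ∃ λ s → S s × q < s
  ; 0◃       = 0<S
  ; bounded  = b , λ (s , s∈S , b<s) → <⇒≱ b<s (S≤b s s∈S)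
  ; down     = λ q<r (s , s∈S , r<s) → s , s∈S , <-trans q<r r<s
  ; rounded  = λ (s , s∈S , q<s) →
                 let r , q<r , r<s = <-dense q<s in r , q<r , s , s∈S , r<s
  }

◃⇒≤ : ∀ x {r b} → r ◃ x → ¬ b ◃ x → r ≤ b
◃⇒≤ x r◃x ¬b◃x = ≮⇒≥ λ b<r → ¬b◃x (ℝ⁺.down x b<r r◃x)

-- sup { r : r² ≤ a }
√ : (a : ℚ) → 0ℚ < a → ℝ⁺
√ a 0<a = sup (λ r → r * r ≤ a) (a ⊓ 1ℚ , square≤ , 0<m) (a ⊔ 1ℚ , bound)
  where
  open ≤-Reasoning
  0<m : 0ℚ < a ⊓ 1ℚ
  0<m with ⊓-sel a 1ℚ
  ... | inj₁ eq = subst (0ℚ <_) (sym eq) 0<a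
  ... | inj₂ eq = subst (0ℚ <_) (sym eq) (positive⁻¹ 1ℚ)
  square≤ : (a ⊓ 1ℚ) * (a ⊓ 1ℚ) ≤ a
  square≤ = begin
    (a ⊓ 1ℚ) * (a ⊓ 1ℚ)  ≤⟨ *-monoˡ-≤-nonNeg (a ⊓ 1ℚ) {{nonNegative (<⇒≤ 0<m)}} (p⊓q≤q a 1ℚ) ⟩
    (a ⊓ 1ℚ) * 1ℚ        ≡⟨ *-identityʳ (a ⊓ 1ℚ) ⟩
    a ⊓ 1ℚ               ≤⟨ p⊓q≤p a 1ℚ ⟩
    a                    ∎
  bound : ∀ s → s * s ≤ a → s ≤ a ⊔ 1ℚ
  bound s s²≤a with ≤-total s 1ℚ
  ... | inj₁ s≤1 = ≤-trans s≤1 (p≤q⊔p a 1ℚ)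
  ... | inj₂ 1≤s = begin
    s        ≡⟨ sym (*-identityʳ s) ⟩
    s * 1ℚ   ≤⟨ *-monoˡ-≤-nonNeg s {{nonNegative (≤-trans (nonNegative⁻¹ 1ℚ) 1≤s)}} 1≤s ⟩
    s * s    ≤⟨ s²≤a ⟩
    a        ≤⟨ p≤p⊔q a 1ℚ ⟩
    a ⊔ 1ℚ   ∎

-- sup { 1/u : u ≥ x }; since u > 0, the condition v * u ≤ 1 says v ≤ 1/u.
infix 10 _⁻¹
_⁻¹ : ℝ⁺ → ℝ⁺
x ⁻¹ = sup (λ v → ∃ λ u → ¬ u ◃ x × v * u ≤ 1ℚ) inhabited bound
  where
  open ≤-Reasoning
  c : ℚ
  c = proj₁ (ℝ⁺.rounded x (ℝ⁺.0◃ x))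
  0<c : 0ℚ < c
  0<c = proj₁ (proj₂ (ℝ⁺.rounded x (ℝ⁺.0◃ x)))
  c≤ : ∀ {u} → ¬ u ◃ x → c ≤ u
  c≤ = ◃⇒≤ x (proj₂ (proj₂ (ℝ⁺.rounded x (ℝ⁺.0◃ x))))
  inhabited : ∃ λ v → (∃ λ u → ¬ u ◃ x × v * u ≤ 1ℚ) × 0ℚ < v
  inhabited = let b , ¬b◃x = ℝ⁺.bounded x
                  instance
                    b>0 : Positive b
                    b>0 = positive (<-≤-trans 0<c (c≤ ¬b◃x))
                    b≢0 : NonZero b
                    b≢0 = pos⇒nonZero b
              in 1/ b , (b , ¬b◃x , ≤-reflexive (*-inverseˡ b)) ,
                 positive⁻¹ (1/ b) {{1/pos⇒pos b}}
  bound : ∃ λ d → ∀ v → (∃ λ u → ¬ u ◃ x × v * u ≤ 1ℚ) → v ≤ d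
  bound = 1/ c , λ v (u , ¬u◃x , vu≤1) → case ≤-total v 0ℚ of λ
    { (inj₁ v≤0) → ≤-trans v≤0 (<⇒≤ (positive⁻¹ (1/ c) {{1/pos⇒pos c}}))
    ; (inj₂ 0≤v) → *-cancelʳ-≤-pos c (begin
        v * c     ≤⟨ *-monoˡ-≤-nonNeg v {{nonNegative 0≤v}} (c≤ ¬u◃x) ⟩
        v * u     ≤⟨ vu≤1 ⟩
        1ℚ        ≡⟨ sym (*-inverseˡ c) ⟩
        1/ c * c  ∎)
    }
    where instance
      c>0 : Positive c
      c>0 = positive 0<c
      c≢0 : NonZero c
      c≢0 = pos⇒nonZero c

-- sup { r s : 0 < r < x, 0 < s < y }
infixl 7 _·_
_·_ : ℝ⁺ → ℝ⁺ → ℝ⁺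
x · y = sup Products
  (let r , 0<r , r◃x = ℝ⁺.rounded x (ℝ⁺.0◃ x)
       s , 0<s , s◃y = ℝ⁺.rounded y (ℝ⁺.0◃ y)
   in r * s , (r , s , 0<r , 0<s , r◃x , s◃y , refl) ,
      positive⁻¹ (r * s) {{pos*pos⇒pos r {{positive 0<r}} s {{positive 0<s}}}})
  (let a , ¬a◃x = ℝ⁺.bounded x
       b , ¬b◃y = ℝ⁺.bounded y
   in a * b , λ { _ (r , s , 0<r , 0<s , r◃x , s◃y , refl) →
        let r≤a = ◃⇒≤ x r◃x ¬a◃x in
        ≤-trans (*-monoˡ-≤-nonNeg r {{nonNegative (<⇒≤ 0<r)}} (◃⇒≤ y s◃y ¬b◃y))
                (*-monoʳ-≤-nonNeg b
                  {{nonNegative (<⇒≤ (<-≤-trans 0<s (◃⇒≤ y s◃y ¬b◃y)))}} r≤a) })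
  where
  Products : ℚ → Set
  Products t = ∃ λ r → ∃ λ s → 0ℚ < r × 0ℚ < s × r ◃ x × s ◃ y × t ≡ r * s

0<2* : ∀ {a} → 0ℚ < a → 0ℚ < ↑ 2 * a
0<2* {a} 0<a = positive⁻¹ (↑ 2 * a) {{pos*pos⇒pos (↑ 2) a {{positive 0<a}}}}

{-# OPTIONS --safe #-}
module Submission where

-- Let X maximise δ. If a vertex v of X had degree less than p (|X| - 1) in
-- G[X], then X - v would have larger δ; so G[X] is full and f(G) ≥ |X|.
-- Moreover α = δ(X) ≤ (1 - p) C(|X|, 2) ≤ (1 - p) |X|² / 2.

open import Defs
import Algebra.Properties.CommutativeSemigroup as CommutativeSemigroup
open import Data.Bool.Base using (true; false)
open import Data.Fin.Base using (Fin)
open import Data.Fin.Subset using (Subset; inside; outside; ⊥; ∣_∣; _∈_) renaming (_-_ to _∖_)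
open import Data.Fin.Subset.Properties using (p─⊥≡p; x∈p∧x≢y⇒x∈p-y)
open import Data.Integer.Base as ℤ using (+_)
import Data.Integer.Properties as ℤ
open import Data.List.Base using (List; []; _∷_; _++_; map; filter; length; allFin)
import Data.List.Extrema as Extrema
import Data.List.Extrema.Nat as ℕExtrema
open import Data.List.Membership.Propositional.Properties
  using (∈-map⁺; ∈-map⁻; ∈-filter⁺; ∈-allFin; ∈-∃++)
open import Data.List.Properties using (length-++; filter-++)
open import Data.List.Relation.Binary.Permutation.Propositional
  using (_↭_; refl; prep; swap; trans; ↭⇒↭ₛ)
open import Data.List.Relation.Binary.Permutation.Propositional.Properties
  using (filter-↭; ↭-length; shift)
import Data.List.Relation.Binary.Permutation.Setoid.Properties as ↭ₛ
open import Data.List.Relation.Unary.All as All using (All; []; _∷_)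
open import Data.List.Relation.Unary.All.Properties using (map⁺; ++⁺)
open import Data.List.Relation.Unary.AllPairs using (_∷_)
open import Data.List.Relation.Unary.Unique.Propositional.Properties using (allFin⁺)
open import Data.Nat.Base as ℕ using (ℕ; suc; NonTrivial)
open import Data.Nat.Combinatorics using (_C_; nC1≡n; nCk+nC[k+1]≡[n+1]C[k+1])
import Data.Nat.Properties as ℕ
import Data.Nat.Tactic.RingSolver as ℕ-Solver
open import Data.Product using (∃; _×_; _,_)
open import Data.Rational hiding (∣_∣)
open import Data.Rational.Properties
open import Data.Rational.Solver using (module +-*-Solver)
import Data.Rational.Unnormalised.Base as ℚᵘ
import Data.Rational.Unnormalised.Properties as ℚᵘ
open import Data.Sum.Base using (inj₁; inj₂)
open import Data.Vec.Base using (_∷_; here; there)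
open import Function.Base using (_∘_; id)
open import Function.Bundles using (mk⇔)
open import Relation.Binary.Bundles using (DecTotalOrder)
open import Relation.Binary.Definitions using (Decidable; Symmetric)
open import Relation.Binary.PropositionalEquality hiding (trans)
import Relation.Binary.PropositionalEquality as ≡
open import Relation.Nullary using (Dec; does; yes; no; contradiction)
open import Relation.Nullary.Decidable using (_×-dec_; does-⇔)

open CommutativeSemigroup ℕ.+-commutativeSemigroup using (x∙yz≈y∙xz)
open Extrema (DecTotalOrder.totalOrder ≤-decTotalOrder) using (argmax-sel; max; xs≤max)

-- Filtered lists and their lengths.

module _ {A : Set} {P Q : A → Set} (P? : ∀ a → Dec (P a)) (Q? : ∀ a → Dec (Q a)) where

  filter-filter : ∀ xs → filter P? (filter Q? xs) ≡ filter (λ a → P? a ×-dec Q? a) xs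
  filter-filter []       = refl
  filter-filter (x ∷ xs) with does (Q? x)
  filter-filter (x ∷ xs) | true with does (P? x)
  ... | true  = cong (x ∷_) (filter-filter xs)
  ... | false = filter-filter xs
  filter-filter (x ∷ xs) | false with does (P? x)
  ... | true  = filter-filter xs
  ... | false = filter-filter xs

  -- The implication is asked only of the entries of the list, because it will be applied to pairs
  -- of vertices known to differ from a deleted vertex.
  length-filter-mono : ∀ {xs} → All (λ a → P a → Q a) xs →
                       length (filter P? xs) ℕ.≤ length (filter Q? xs)
  length-filter-mono []                         = ℕ.z≤n
  length-filter-mono {x ∷ _} (p⇒q ∷ ps) with P? x | Q? x
  ... | yes _ | yes _ = ℕ.s≤s (length-filter-mono ps)
  ... | yes p | no ¬q = contradiction (p⇒q p) ¬q
  ... | no _  | yes _ = ℕ.m≤n⇒m≤1+n (length-filter-mono ps)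
  ... | no _  | no _  = length-filter-mono ps

All-pairs : ∀ {A : Set} {P : A → Set} {xs} → All P xs →
            All (λ (x , y) → P x × P y) (pairs xs)
All-pairs []       = []
All-pairs (p ∷ ps) = ++⁺ (map⁺ (All.map (p ,_) ps)) (All-pairs ps)

-- Counting related pairs, independently of the order of the list.

module _ {A : Set} {R : A → A → Set} (R? : Decidable R) where

  #pairs : List A → ℕ
  #pairs xs = length (filter (λ (x , y) → R? x y) (pairs xs))

  -- This separates the edges at a vertex placed first in the list from the edges that avoid it.
  #pairs-∷ : ∀ x xs → #pairs (x ∷ xs) ≡ length (filter (R? x) xs) ℕ.+ #pairs xs
  #pairs-∷ x xs = begin
    length (filter R²? (map (x ,_) xs ++ pairs xs))
      ≡⟨ cong length (filter-++ R²? (map (x ,_) xs) (pairs xs)) ⟩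
    length (filter R²? (map (x ,_) xs) ++ filter R²? (pairs xs))
      ≡⟨ length-++ (filter R²? (map (x ,_) xs)) ⟩
    length (filter R²? (map (x ,_) xs)) ℕ.+ #pairs xs
      ≡⟨ cong (ℕ._+ #pairs xs) (length-filter-map R²? (x ,_) xs) ⟩
    length (filter (R? x) xs) ℕ.+ #pairs xs ∎
    where
    open ≡-Reasoning
    R²? : (xy : A × A) → Dec _
    R²? (x , y) = R? x y

  #pairs-prep : ∀ x {xs ys} → xs ↭ ys → #pairs xs ≡ #pairs ys →
                #pairs (x ∷ xs) ≡ #pairs (x ∷ ys)
  #pairs-prep x {xs} {ys} p eq = begin
    #pairs (x ∷ xs)                           ≡⟨ #pairs-∷ x xs ⟩
    length (filter (R? x) xs) ℕ.+ #pairs xs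
      ≡⟨ cong₂ ℕ._+_ (↭-length (filter-↭ (R? x) p)) eq ⟩
    length (filter (R? x) ys) ℕ.+ #pairs ys   ≡⟨ #pairs-∷ x ys ⟨
    #pairs (x ∷ ys)                           ∎
    where open ≡-Reasoning

  -- The two entries meet as (x, y) on one side and as (y, x) on the other, and symmetry of R
  -- identifies these tests. Otherwise only the rows of x and y trade places in the sum.
  #pairs-swap : Symmetric R → ∀ x y xs → #pairs (x ∷ y ∷ xs) ≡ #pairs (y ∷ x ∷ xs)
  #pairs-swap R-sym x y xs
    rewrite #pairs-∷ x (y ∷ xs) | #pairs-∷ y xs | #pairs-∷ y (x ∷ xs) | #pairs-∷ x xs
    with does (R? x y) | does (R? y x) | does-⇔ (mk⇔ R-sym R-sym) (R? x y) (R? y x)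
  ... | true  | true  | _ = cong suc (x∙yz≈y∙xz (length (filter (R? x) xs)) (length (filter (R? y) xs)) (#pairs xs))
  ... | false | false | _ = x∙yz≈y∙xz (length (filter (R? x) xs)) (length (filter (R? y) xs)) (#pairs xs)

  -- `edges` takes its pairs in the order of `allFin n`; invariance allows any chosen vertex to be
  -- moved to the front.
  #pairs-↭ : Symmetric R → ∀ {xs ys} → xs ↭ ys → #pairs xs ≡ #pairs ys
  #pairs-↭ R-sym refl       = refl
  #pairs-↭ R-sym (prep x p) = #pairs-prep x p (#pairs-↭ R-sym p)
  #pairs-↭ R-sym (swap {xs} x y p) = ≡.trans (#pairs-swap R-sym x y xs)
    (#pairs-prep y (prep x p) (#pairs-prep x p (#pairs-↭ R-sym p)))
  #pairs-↭ R-sym (trans p q) = ≡.trans (#pairs-↭ R-sym p) (#pairs-↭ R-sym q)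

-- Having no repeated entries survives permutation, so once v is at the head it cannot recur in the
-- rest.
allFin-↭ : ∀ {n} (v : Fin n) → ∃ λ us → allFin n ↭ v ∷ us × All (v ≢_) us
allFin-↭ {n} v with ∈-∃++ (∈-allFin v)
... | xs , ys , eq
  with p ← subst (_↭ v ∷ xs ++ ys) (sym eq) (shift v xs ys)
  with v≢ ∷ _ ← ↭ₛ.Unique-resp-↭ (setoid (Fin n)) (↭⇒↭ₛ p) (allFin⁺ n)
  = xs ++ ys , p , v≢

-- Edges lost when a vertex is deleted.

module _ {n : ℕ} where

  -- With v listed first, the row of v contributes at most its degree, and every later pair avoids
  -- v, so that an edge of G there is also an edge of H.
  length-edges-≤ : ∀ (G H : Graph n) v →
    (∀ {u w} → v ≢ u → v ≢ w → Graph._~_ G u w → Graph._~_ H u w) →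
    length (edges G) ℕ.≤ degree G v ℕ.+ length (edges H)
  length-edges-≤ G H v G⇒H with us , p , v≢us ← allFin-↭ v = begin
    length (edges G)         ≡⟨ #pairs-↭ G._~?_ G.~-sym p ⟩
    #pairs G._~?_ (v ∷ us)   ≡⟨ #pairs-∷ G._~?_ v us ⟩
    length (filter (v G.~?_) us) ℕ.+ #pairs G._~?_ us
      ≤⟨ ℕ.+-mono-≤ degree≥
           (length-filter-mono _ _ (All.map (λ (v≢u , v≢w) → G⇒H v≢u v≢w) (All-pairs v≢us))) ⟩
    degree G v ℕ.+ #pairs H._~?_ us
      -- The row of v in H is added so that the sum becomes the edge count of H.
      ≤⟨ ℕ.+-monoʳ-≤ (degree G v) (ℕ.m≤n+m _ (length (filter (v H.~?_) us))) ⟩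
    degree G v ℕ.+ (length (filter (v H.~?_) us) ℕ.+ #pairs H._~?_ us)
      ≡⟨ cong (degree G v ℕ.+_) (#pairs-∷ H._~?_ v us) ⟨
    degree G v ℕ.+ #pairs H._~?_ (v ∷ us)
      ≡⟨ cong (degree G v ℕ.+_) (#pairs-↭ H._~?_ H.~-sym p) ⟨
    degree G v ℕ.+ length (edges H) ∎
    where
    open ℕ.≤-Reasoning
    module G = Graph G
    module H = Graph H
    degree≥ : length (filter (v G.~?_) us) ℕ.≤ degree G v
    -- `degree` runs over all vertices, v included, so testing v against itself can only enlarge the
    -- count.
    degree≥ rewrite ↭-length (filter-↭ (v G.~?_) p) with does (v G.~? v)
    ... | true  = ℕ.n≤1+n _
    ... | false = ℕ.≤-refl

  module _ (G : Graph n) where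

    G[_] : Subset n → Graph n
    G[ X ] = Subgraph.graph (induced G X)

    e≡length-edges : ∀ X → e G X ≡ length (edges G[ X ])
    e≡length-edges X = cong length (filter-filter _ _ (pairs (allFin n)))

    -- An edge of G[X] with both ends different from v has both ends in X - v, so only edges at v
    -- are lost.
    e≤degree+e : ∀ X v → e G X ℕ.≤ degree G[ X ] v ℕ.+ e G (X ∖ v)
    e≤degree+e X v rewrite e≡length-edges X | e≡length-edges (X ∖ v) =
      length-edges-≤ G[ X ] G[ X ∖ v ] v
        λ v≢u v≢w ((u∈X , w∈X) , u~w) →
          (x∈p∧x≢y⇒x∈p-y u∈X (v≢u ∘ sym) , x∈p∧x≢y⇒x∈p-y w∈X (v≢w ∘ sym)) , u~w

-- Set sizes, binomials and their passage to the rationals.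

suc∣p-x∣≡∣p∣ : ∀ {n} {p : Subset n} {x} → x ∈ p → suc ∣ p ∖ x ∣ ≡ ∣ p ∣
-- Removing the first element subtracts a singleton whose tail is empty, so the tail of the set is
-- unchanged.
suc∣p-x∣≡∣p∣ {p = _ ∷ p}       here        = cong (suc ∘ ∣_∣) (p─⊥≡p p)
suc∣p-x∣≡∣p∣ {p = inside ∷ _}  (there x∈p) = cong suc (suc∣p-x∣≡∣p∣ x∈p)
suc∣p-x∣≡∣p∣ {p = outside ∷ _} (there x∈p) = suc∣p-x∣≡∣p∣ x∈p

[1+n]C2≡n+nC2 : ∀ n → suc n C 2 ≡ n ℕ.+ n C 2
[1+n]C2≡n+nC2 n =
  ≡.trans (sym (nCk+nC[k+1]≡[n+1]C[k+1] n 1)) (cong (ℕ._+ n C 2) (nC1≡n n))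

-- Here n (n - 1) is relaxed to n², to bring the estimate into the form of a square. The induction
-- gives away 1 at each step, from (n + 1)² = n² + 2n + 1.
2*nC2≤n*n : ∀ n → 2 ℕ.* (n C 2) ℕ.≤ n ℕ.* n
2*nC2≤n*n 0       = ℕ.z≤n
2*nC2≤n*n (suc n) = begin
  2 ℕ.* (suc n C 2)               ≡⟨ cong (2 ℕ.*_) ([1+n]C2≡n+nC2 n) ⟩
  2 ℕ.* (n ℕ.+ n C 2)             ≡⟨ ℕ.*-distribˡ-+ 2 n (n C 2) ⟩
  2 ℕ.* n ℕ.+ 2 ℕ.* (n C 2)       ≤⟨ ℕ.+-monoʳ-≤ (2 ℕ.* n) (2*nC2≤n*n n) ⟩
  2 ℕ.* n ℕ.+ n ℕ.* n             ≤⟨ ℕ.n≤1+n _ ⟩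
  1 ℕ.+ (2 ℕ.* n ℕ.+ n ℕ.* n)     ≡⟨ square n ⟩
  suc n ℕ.* suc n                 ∎
  where
  open ℕ.≤-Reasoning
  square : ∀ n → 1 ℕ.+ (2 ℕ.* n ℕ.+ n ℕ.* n) ≡ suc n ℕ.* suc n
  square = ℕ-Solver.solve-∀

toℚᵘ-↑ : ∀ m → toℚᵘ (↑ m) ℚᵘ.≃ ℚᵘ.mkℚᵘ (+ m) 0
toℚᵘ-↑ m = toℚᵘ-fromℚᵘ (ℚᵘ.mkℚᵘ (+ m) 0)

-- `↑` normalises its fraction, so the identity is checked on unnormalised fractions with
-- denominator 1 and carried back.
↑-+ : ∀ m k → ↑ (m ℕ.+ k) ≡ ↑ m + ↑ k
↑-+ m k = toℚᵘ-injective (begin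
  toℚᵘ (↑ (m ℕ.+ k))                         ≈⟨ toℚᵘ-↑ (m ℕ.+ k) ⟩
  ℚᵘ.mkℚᵘ (+ (m ℕ.+ k)) 0                    ≈⟨ ℚᵘ.*≡* (cong (ℤ._* + 1)
    (sym (cong₂ ℤ._+_ (ℤ.*-identityʳ (+ m)) (ℤ.*-identityʳ (+ k))))) ⟩
  ℚᵘ.mkℚᵘ (+ m) 0 ℚᵘ.+ ℚᵘ.mkℚᵘ (+ k) 0       ≈⟨ ℚᵘ.+-cong (toℚᵘ-↑ m) (toℚᵘ-↑ k) ⟨
  toℚᵘ (↑ m) ℚᵘ.+ toℚᵘ (↑ k)                 ≈⟨ toℚᵘ-homo-+ (↑ m) (↑ k) ⟨
  toℚᵘ (↑ m + ↑ k)                           ∎)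
  where open ℚᵘ.≃-Reasoning

↑-* : ∀ m k → ↑ (m ℕ.* k) ≡ ↑ m * ↑ k
↑-* m k = toℚᵘ-injective (begin
  toℚᵘ (↑ (m ℕ.* k))                         ≈⟨ toℚᵘ-↑ (m ℕ.* k) ⟩
  ℚᵘ.mkℚᵘ (+ (m ℕ.* k)) 0                    ≈⟨ ℚᵘ.*≡* (cong (ℤ._* + 1) (ℤ.pos-* m k)) ⟩
  ℚᵘ.mkℚᵘ (+ m) 0 ℚᵘ.* ℚᵘ.mkℚᵘ (+ k) 0       ≈⟨ ℚᵘ.*-cong (toℚᵘ-↑ m) (toℚᵘ-↑ k) ⟨
  toℚᵘ (↑ m) ℚᵘ.* toℚᵘ (↑ k)                 ≈⟨ toℚᵘ-homo-* (↑ m) (↑ k) ⟨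
  toℚᵘ (↑ m * ↑ k)                           ∎)
  where open ℚᵘ.≃-Reasoning

-- Inequalities over the rationals.

module _ where
  open +-*-Solver
  open ≤-Reasoning

  -- With k = |X| - 1 and c = C(k, 2), the hypotheses compare X with X minus
  -- a vertex of degree d.
  deletion-bound : ∀ p k c e e′ d → e′ - p * c ≤ e - p * (k + c) → e ≤ d + e′ →
                   p * (1ℚ + k - 1ℚ) ≤ d
  deletion-bound p k c e e′ d δ′≤δ e≤d+e′ = begin
    p * (1ℚ + k - 1ℚ)
      -- Adding and subtracting e′ brings in the discrepancy of the smaller set. The constant 1 is
      -- passed as a variable i, since it cancels.
      ≡⟨ solve 5 (λ p k c e′ i → p :* (i :+ k :- i) :=
           (e′ :- p :* c) :+ (p :* (k :+ c) :- e′)) refl p k c e′ 1ℚ ⟩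
    (e′ - p * c) + (p * (k + c) - e′)
      ≤⟨ +-monoˡ-≤ (p * (k + c) - e′) δ′≤δ ⟩
    (e - p * (k + c)) + (p * (k + c) - e′)
      ≡⟨ solve 3 (λ e x e′ → (e :- x) :+ (x :- e′) := e :- e′) refl e (p * (k + c)) e′ ⟩
    e - e′
      ≤⟨ +-monoˡ-≤ (- e′) e≤d+e′ ⟩
    d + e′ - e′
      ≡⟨ solve 2 (λ d e′ → d :+ e′ :- e′ := d) refl d e′ ⟩
    d ∎

  -- Applied with t = 2, c = C(|X|, 2) and `m²` = |X|². Replacing e by c leaves c - p c, whence the
  -- factor 1 - p.
  discrepancy-bound : ∀ t p c e m² .{{_ : NonNegative t}} → 0ℚ ≤ 1ℚ - p →
                      e ≤ c → t * c ≤ m² → t * (e - p * c) ≤ (1ℚ - p) * m²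
  discrepancy-bound t p c e m² 0≤1-p e≤c tc≤m² = begin
    t * (e - p * c)
      ≤⟨ *-monoˡ-≤-nonNeg t (+-monoˡ-≤ (- (p * c)) e≤c) ⟩
    t * (c - p * c)
      ≡⟨ solve 3 (λ t p c → t :* (c :- p :* c) := (con 1ℚ :- p) :* (t :* c)) refl t p c ⟩
    (1ℚ - p) * (t * c)
      ≤⟨ *-monoˡ-≤-nonNeg (1ℚ - p) {{nonNegative 0≤1-p}} tc≤m² ⟩
    (1ℚ - p) * m² ∎

-- A set of maximum discrepancy.

max-map-attained : ∀ {A : Set} (g : A → ℚ) x xs → ∃ λ y → max (g x) (map g xs) ≡ g y
-- The starting value of the maximum is itself a value of g, so both outcomes of `argmax-sel` give a
-- witness.
max-map-attained g x xs with argmax-sel id (g x) (map g xs)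
... | inj₁ eq = x , eq
... | inj₂ m∈ with y , _ , eq ← ∈-map⁻ g m∈ = y , eq

module _ {n : ℕ} .{{_ : NonTrivial n}} (G : Graph n) where

  δ≤disc⁺ : ∀ X → δ G X ≤ disc⁺ G
  δ≤disc⁺ X = All.lookup (xs≤max (δ G ⊥) (map (δ G) (subsets n))) (∈-map⁺ (δ G) (∈-subsets X))

  disc⁺-attained : ∃ λ X → disc⁺ G ≡ δ G X
  disc⁺-attained = max-map-attained (δ G) ⊥ (subsets n)

  -- Maximality is applied to X - v for each v in X. Both |X| and C(|X|, 2) are rewritten through |X
  -- - v|, the form that `deletion-bound` expects.
  δ-maximal⇒full : ∀ X → disc⁺ G ≡ δ G X → Full G (induced G X)
  δ-maximal⇒full X disc≡ v v∈X =
    subst (λ m → density G * (m - 1ℚ) ≤ ↑ d) (sym ↑∣X∣)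
      (deletion-bound (density G) (↑ ∣ X ∖ v ∣) (↑ (∣ X ∖ v ∣ C 2)) (↑ e G X) (↑ e G (X ∖ v)) (↑ d)
        (subst (λ c → δ G (X ∖ v) ≤ ↑ e G X - density G * c) ↑C2
          (subst (δ G (X ∖ v) ≤_) disc≡ (δ≤disc⁺ (X ∖ v))))
        (subst (↑ e G X ≤_) (↑-+ d (e G (X ∖ v))) (↑-mono-≤ (e≤degree+e G X v))))
    where
    d : ℕ
    d = degree (G[_] G X) v
    ↑∣X∣ : ↑ ∣ X ∣ ≡ 1ℚ + ↑ ∣ X ∖ v ∣
    ↑∣X∣ = ≡.trans (cong ↑_ (sym (suc∣p-x∣≡∣p∣ v∈X))) (↑-+ 1 ∣ X ∖ v ∣)
    ↑C2 : ↑ (∣ X ∣ C 2) ≡ ↑ ∣ X ∖ v ∣ + ↑ (∣ X ∖ v ∣ C 2)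
    ↑C2 = ≡.trans (cong (λ m → ↑ (m C 2)) (sym (suc∣p-x∣≡∣p∣ v∈X)))
         (≡.trans (cong ↑_ ([1+n]C2≡n+nC2 ∣ X ∖ v ∣)) (↑-+ ∣ X ∖ v ∣ (∣ X ∖ v ∣ C 2)))

  full⇒∣X∣≤f : ∀ X → Full G (induced G X) → ∣ X ∣ ℕ.≤ f G
  full⇒∣X∣≤f X full = All.lookup (ℕExtrema.xs≤max 0 _)
    (∈-map⁺ ∣_∣ (∈-filter⁺ (spansFull? G) (∈-subsets X) (induced G X , refl , full)))

  2δ≤[1-p]∣X∣² : 0ℚ ≤ 1ℚ - density G → ∀ X →
                 ↑ 2 * δ G X ≤ (1ℚ - density G) * (↑ ∣ X ∣ * ↑ ∣ X ∣)
  2δ≤[1-p]∣X∣² 0≤1-p X =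
    discrepancy-bound (↑ 2) (density G) (↑ (∣ X ∣ C 2)) (↑ e G X) (↑ ∣ X ∣ * ↑ ∣ X ∣) 0≤1-p
      (↑-mono-≤ (e≤ G X))
      (subst₂ _≤_ (↑-* 2 (∣ X ∣ C 2)) (↑-* ∣ X ∣ ∣ X ∣) (↑-mono-≤ (2*nC2≤n*n ∣ X ∣)))

-- Comparison with the cut of a quotient of square roots.

-- If u ≥ √a and w² ≤ b ≤ a m², then (w/m)² ≤ a, so w/m ≤ u.
√a⁻¹√b≤m : ∀ {a b m} (0<a : 0ℚ < a) (0<b : 0ℚ < b) → 0ℚ ≤ m → b ≤ a * (m * m) →
           m ≥ᴿ (√ a 0<a) ⁻¹ · √ b 0<b
-- Unfolding the cuts: q < r s, where r lies below some v ≤ 1/u with u not below √a, and s below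
-- some w with w² ≤ b.
√a⁻¹√b≤m {a} {b} {m} 0<a 0<b 0≤m b≤am² {q}
  (_ , (r , s , 0<r , 0<s , (v , (u , u≮√a , vu≤1) , r<v) , (w , w²≤b , s<w) , refl) , q<rs)
  = begin
    q                  ≤⟨ <⇒≤ q<rs ⟩
    r * s              ≤⟨ *-monoˡ-≤-nonNeg r {{nonNegative (<⇒≤ 0<r)}} (<⇒≤ s<w) ⟩
    r * w              ≤⟨ *-monoʳ-≤-nonNeg w {{nonNegative (<⇒≤ (<-trans 0<s s<w))}} (<⇒≤ r<v) ⟩
    v * w              ≡⟨ cong (v *_) w≡ ⟩
    v * (w/m * m)      ≤⟨ *-monoˡ-≤-nonNeg v {{nonNegative (<⇒≤ (<-trans 0<r r<v))}}
                            (*-monoʳ-≤-nonNeg m {{nonNegative 0≤m}} w/m≤u) ⟩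
    v * (u * m)        ≡⟨ *-assoc v u m ⟨
    v * u * m          ≤⟨ *-monoʳ-≤-nonNeg m {{nonNegative 0≤m}} vu≤1 ⟩
    1ℚ * m             ≡⟨ *-identityˡ m ⟩
    m                  ∎
  where
  open ≤-Reasoning
  0<m : 0ℚ < m
  -- m = 0 would give b ≤ 0; hence division by m is possible.
  0<m = ≰⇒> λ m≤0 → <⇒≱ 0<b (begin
    b              ≤⟨ b≤am² ⟩
    a * (m * m)    ≡⟨ cong (λ x → a * (x * x)) (≤-antisym m≤0 0≤m) ⟩
    a * (0ℚ * 0ℚ)  ≡⟨ *-zeroʳ a ⟩
    0ℚ             ∎)
  instance
    m>0 : Positive m
    m>0 = positive 0<m
    m≢0 : NonZero m
    m≢0 = pos⇒nonZero m
    m²>0 : Positive (m * m)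
    m²>0 = pos*pos⇒pos m m
  w/m : ℚ
  w/m = w * 1/ m
  w≡ : w ≡ w/m * m
  w≡ = begin-equality
    w                ≡⟨ *-identityʳ w ⟨
    w * 1ℚ           ≡⟨ cong (w *_) (*-inverseˡ m) ⟨
    w * (1/ m * m)   ≡⟨ *-assoc w (1/ m) m ⟨
    w/m * m          ∎
  w/m≤u : w/m ≤ u
  -- Otherwise w/m would be a rational above u with square at most a, which puts u in the cut of √a.
  -- The bound on its square is checked after multiplying by m² > 0.
  w/m≤u = ≮⇒≥ λ u<w/m → u≮√a (w/m , *-cancelʳ-≤-pos (m * m) (begin
    w/m * w/m * (m * m)
      ≡⟨ solve 2 (λ x m → x :* x :* (m :* m) := (x :* m) :* (x :* m)) refl w/m m ⟩
    (w/m * m) * (w/m * m)  ≡⟨ cong₂ _*_ w≡ w≡ ⟨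
    w * w                  ≤⟨ w²≤b ⟩
    b                      ≤⟨ b≤am² ⟩
    a * (m * m)            ∎) , u<w/m)
    where open +-*-Solver

theorem2 : ∀ {n : ℕ} .{{_ : NonTrivial n}} (G : Graph n) (p α : ℚ)
    (p≡ : density G ≡ p) (α≡ : disc⁺ G ≡ α) (0<α : 0ℚ < α) →
    ↑ (f G) ≥ᴿ (√ (1ℚ - p) (0<1-p G p≡ α≡ 0<α)) ⁻¹ · √ (↑ 2 * α) (0<2* 0<α)
theorem2 G _ _ refl refl 0<α r◃x =
  let X , disc≡ = disc⁺-attained G
      0<1-p     = 0<1-p G refl refl 0<α
  -- The bound is proved with m = |X|, where α = δ(X), and then |X| ≤ f(G) is appended.
  in ≤-trans
       (√a⁻¹√b≤m 0<1-p (0<2* 0<α) (↑-mono-≤ {0} {∣ X ∣} ℕ.z≤n)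
         (subst (λ α → ↑ 2 * α ≤ (1ℚ - density G) * (↑ ∣ X ∣ * ↑ ∣ X ∣)) (sym disc≡)
           (2δ≤[1-p]∣X∣² G (<⇒≤ 0<1-p) X))
         r◃x)
       (↑-mono-≤ (full⇒∣X∣≤f G X (δ-maximal⇒full G X disc≡)))
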